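{- With high probability, $Q^n(1)$ does not contain a connected component spanning $\Omega(2^n)$ vertices. That is, for every fixed $\varepsilon>0$, the probability that $Q^n(1)$ has a connected component with at least $\varepsilon 2^n$ vertices tends to $0$ as $n\to\infty$.
   Context: $Q^n$ is the $n$-dimensional cube: the graph with vertex set $V=\{0,1\}^n$ in which two vertices are adjacent iff they differ in precisely one coordinate. For an integer $1\le k\le n-1$, $Q^n(k)$ (the $k$-out model) is the random (simple, undirected) spanning subgraph of $Q^n$ with vertex set $V$ obtained as follows: independently for every $v\in V$, choose a set of $k$ distinct edges uniformly from all the $\binom{n}{k}$ sets of $k$ distinct edges of $Q^n$ incident to $v$; the edge set of $Q^n(k)$ is the union of all chosen sets. A sequence of events holds with high probability (w.h.p.) if its probability tends to $1$ as $n\to\infty$. -}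

module Defs where

open import Data.Bool using (Bool; true; false)
import Data.Bool.Properties as Bool
open import Data.Fin using (Fin)
import Data.Fin.Properties as Fin
open import Data.Fin.Subset using (Subset) renaming (_∈_ to _∈ˢ_; ∣_∣ to ∣_∣ˢ)
open import Data.Fin.Subset.Properties using () renaming (_∈?_ to _∈ˢ?_)
open import Data.Integer using (+_)
open import Data.List using (List; []; _∷_; [_]; _++_; map; filter; length; cartesianProductWith)
open import Data.List.Membership.Propositional using (_∈_; find; lose)
open import Data.List.Membership.Propositional.Properties using (∈-++⁺ˡ; ∈-++⁺ʳ; ∈-map⁺)
open import Data.List.Relation.Unary.Any using (here; there; any?)
open import Data.Nat as ℕ using (ℕ; zero; suc)
open import Data.Product using (∃-syntax; _×_; _,_; map₂; proj₂)
open import Data.Rational using (ℚ; 0ℚ; _/_; _≤_; _<_; ∣_∣)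
import Data.Rational.Properties as ℚ
open import Data.Sum using (_⊎_; inj₁; inj₂; swap)
open import Data.Vec using (Vec; []; _∷_; lookup)
import Data.Vec.Properties as Vec
open import Function using (_∘_)
open import Level using (Level)
open import Relation.Binary.Construct.Closure.ReflexiveTransitive using (Star; ε; _◅_; _◅◅_)
open import Relation.Binary.Definitions using (Decidable; Symmetric; Irreflexive)
open import Relation.Binary.PropositionalEquality using (_≡_; _≢_; refl; sym)
open import Relation.Nullary using (Dec; ¬?)
open import Relation.Nullary.Decidable using (map′; _×-dec_; _⊎-dec_; _→-dec_)
import Relation.Unary as U

private
  variable
    n : ℕ
    a p : Level
    A : Set a

V : ℕ → Set
V n = Vec Bool n

vertices : ∀ n → List (V n)
vertices zero    = [ [] ]
vertices (suc n) = map (false ∷_) (vertices n) ++ map (true ∷_) (vertices n)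

∈-vertices : (v : V n) → v ∈ vertices n
∈-vertices []          = here refl
∈-vertices (false ∷ v) = ∈-++⁺ˡ (∈-map⁺ (false ∷_) (∈-vertices v))
∈-vertices (true  ∷ v) = ∈-++⁺ʳ (map (false ∷_) (vertices _)) (∈-map⁺ (true ∷_) (∈-vertices v))

_≟ⱽ_ : Decidable {A = V n} _≡_
_≟ⱽ_ = Vec.≡-dec Bool._≟_

record Graph (n : ℕ) : Set₁ where
  field
    Adj    : V n → V n → Set
    adj?   : Decidable Adj
    symm   : Symmetric Adj
    irrefl : Irreflexive _≡_ Adj

  Connected : V n → V n → Set
  Connected = Star Adj

  -- Connected is decidable: Via zs u v says that some walk from u to v has
  -- all of its internal vertices in zs (Warshall's recursion).
  private
    Via : List (V n) → V n → V n → Set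
    Via []       u v = u ≡ v ⊎ Adj u v
    Via (z ∷ zs) u v = Via zs u v ⊎ (Via zs u z × Via zs z v)

    via? : ∀ zs → Decidable (Via zs)
    via? []       u v = (u ≟ⱽ v) ⊎-dec adj? u v
    via? (z ∷ zs) u v = via? zs u v ⊎-dec (via? zs u z ×-dec via? zs z v)

    via⇒connected : ∀ zs {u v} → Via zs u v → Connected u v
    via⇒connected []       (inj₁ refl)    = ε
    via⇒connected []       (inj₂ e)       = e ◅ ε
    via⇒connected (z ∷ zs) (inj₁ q)       = via⇒connected zs q
    via⇒connected (z ∷ zs) (inj₂ (q , r)) = via⇒connected zs q ◅◅ via⇒connected zs r

    via-base : ∀ zs {u v} → u ≡ v ⊎ Adj u v → Via zs u v
    via-base []       q = q
    via-base (z ∷ zs) q = inj₁ (via-base zs q)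

    to-head : ∀ {z} zs {u} → Via (z ∷ zs) u z → Via zs u z
    to-head zs (inj₁ q)       = q
    to-head zs (inj₂ (q , _)) = q

    from-head : ∀ {z} zs {v} → Via (z ∷ zs) z v → Via zs z v
    from-head zs (inj₁ q)       = q
    from-head zs (inj₂ (_ , q)) = q

    via-trans : ∀ zs {u w v} → w ∈ zs → Via zs u w → Via zs w v → Via zs u v
    via-trans (z ∷ zs) (here refl) q r = inj₂ (to-head zs q , from-head zs r)
    via-trans (z ∷ zs) (there w∈) (inj₁ q)       (inj₁ r)       = inj₁ (via-trans zs w∈ q r)
    via-trans (z ∷ zs) (there w∈) (inj₁ q)       (inj₂ (r , s)) = inj₂ (via-trans zs w∈ q r , s)
    via-trans (z ∷ zs) (there w∈) (inj₂ (q , r)) (inj₁ s)       = inj₂ (q , via-trans zs w∈ r s)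
    via-trans (z ∷ zs) (there w∈) (inj₂ (q , _)) (inj₂ (_ , s)) = inj₂ (q , s)

    connected⇒via : ∀ {u v} → Connected u v → Via (vertices n) u v
    connected⇒via ε       = via-base (vertices n) (inj₁ refl)
    connected⇒via (e ◅ q) =
      via-trans (vertices n) (∈-vertices _) (via-base (vertices n) (inj₂ e)) (connected⇒via q)

  connected? : Decidable Connected
  connected? u v = map′ (via⇒connected (vertices n)) connected⇒via (via? (vertices n) u v)

  component : V n → List (V n)
  component v = filter (connected? v) (vertices n)

  HasComponentOfOrder≥ : ℚ → Set
  HasComponentOfOrder≥ t = ∃[ v ] t ≤ + length (component v) / 1

  hasComponentOfOrder≥? : U.Decidable HasComponentOfOrder≥
  hasComponentOfOrder≥? t =
    map′ (λ q → map₂ proj₂ (find q)) (λ (v , q) → lose (∈-vertices v) q)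
         (any? (λ v → t ℚ.≤? (+ length (component v) / 1)) (vertices n))

DifferOnlyAt : Fin n → V n → V n → Set
DifferOnlyAt i u v =
  lookup u i ≢ lookup v i × (∀ j → j ≢ i → lookup u j ≡ lookup v j)

differOnlyAt? : ∀ i → Decidable (DifferOnlyAt {n} i)
differOnlyAt? i u v =
  ¬? (lookup u i Bool.≟ lookup v i)
  ×-dec Fin.all? (λ j → ¬? (j Fin.≟ i) →-dec (lookup u j Bool.≟ lookup v j))

differOnlyAt-sym : ∀ (i : Fin n) u v → DifferOnlyAt i u v → DifferOnlyAt i v u
differOnlyAt-sym _ _ _ (d , s) = d ∘ sym , λ j j≢i → sym (s j j≢i)

cube : ∀ n → Graph n
cube n = record
  { Adj    = λ u v → ∃[ i ] DifferOnlyAt i u v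
  ; adj?   = λ u v → Fin.any? (λ i → differOnlyAt? i u v)
  ; symm   = λ {u} {v} (i , d) → i , differOnlyAt-sym i u v d
  ; irrefl = λ { refl (i , d , _) → d refl }
  }

-- The edges of the cube incident to v correspond to the n coordinates (the
-- edge at v in direction i joins v to the vertex differing from v only at i),
-- so a set of edges incident to v is a subset of Fin n.
Choice : ℕ → Set
Choice n = V n → Subset n

outGraph : Choice n → Graph n
outGraph ω = record
  { Adj    = λ u v → ∃[ i ] (DifferOnlyAt i u v × (i ∈ˢ ω u ⊎ i ∈ˢ ω v))
  ; adj?   = λ u v → Fin.any? (λ i → differOnlyAt? i u v ×-dec ((i ∈ˢ? ω u) ⊎-dec (i ∈ˢ? ω v)))
  ; symm   = λ {u} {v} (i , d , c) → i , differOnlyAt-sym i u v d , swap c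
  ; irrefl = λ { refl (i , (d , _) , _) → d refl }
  }

outGraph⊆cube : ∀ (ω : Choice n) {u v} → Graph.Adj (outGraph ω) u v → Graph.Adj (cube n) u v
outGraph⊆cube ω (i , d , _) = i , d

-- Subset n and V n are both Vec Bool n.
kSubsets : ∀ n → ℕ → List (Subset n)
kSubsets n k = filter (λ s → ∣ s ∣ˢ ℕ.≟ k) (vertices n)

glue : (V n → A) → (V n → A) → V (suc n) → A
glue f g (false ∷ v) = f v
glue f g (true  ∷ v) = g v

-- All maps from V n to the elements of the list, each listed once (up to
-- pointwise equality) when the list has no repetitions.
allMaps : ∀ n → List A → List (V n → A)
allMaps zero    xs = map (λ x _ → x) xs
allMaps (suc n) xs = cartesianProductWith glue (allMaps n xs) (allMaps n xs)

-- Choosing a k-set independently and uniformly at each vertex is choosing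
-- uniformly from this list.
choices : ∀ n → ℕ → List (Choice n)
choices n k = allMaps n (kSubsets n k)

-- Only the value for a nonzero denominator is meaningful.
ratio : ℕ → ℕ → ℚ
ratio m zero    = 0ℚ
ratio m (suc d) = + m / suc d

uniform : {P : U.Pred A p} → List A → U.Decidable P → ℚ
uniform xs P? = ratio (length (filter P? xs)) (length xs)

-- The probability that Q^n(k) has the property P.  The list of choices is
-- nonempty whenever k ≤ n.
ℙ[Q_out_⊨_] : ∀ n k {P : Graph n → Set p} → (∀ G → Dec (P G)) → ℚ
ℙ[Q n out k ⊨ P? ] = uniform (choices n k) (λ ω → P? (outGraph ω))

TendsToZero : (ℕ → ℚ) → Set
TendsToZero x = ∀ δ → 0ℚ < δ → ∃[ N ] (∀ n → N ℕ.≤ n → ∣ x n ∣ < δ)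

{-# OPTIONS --safe #-}

-- Every vertex v picks one direction, so Q^n(1) is the functional graph of a
-- random map, and u and v lie in the same component iff their orbits meet.
-- Expose the orbit of u step by step until it closes up.  Each new step returns
-- to the previous vertex with probability 1/n, so the orbit has at most n²
-- vertices except with probability (1 - 1/n)^(n²) ≤ 2^(-n).  Given this orbit T,
-- the orbit of v is, until it hits T or itself, a simple random walk.  Summed
-- over all v, the walk is at a given vertex at a given time with total
-- probability 1, so on average at most |T| (n² + 2) of the v reach T in time.
-- Hence the expected number of connected pairs is 2^n poly(n), whereas a
-- component of order ε 2^n alone contributes ε² 4^n; conclude by Markov.
module Submission where

open import Defs
open import Data.Bool using (true; false; _xor_; if_then_else_)
import Data.Bool.Properties as Bool
open import Data.Fin using (zero; suc)
open import Data.Fin.Properties using () renaming (suc-injective to suc-injectiveᶠ)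
open import Data.Fin.Subset using (Subset) renaming (_∈_ to _∈ˢ_; ∣_∣ to ∣_∣ˢ)
import Data.Integer as ℤ
import Data.Integer.Properties as ℤ
open import Data.List using (List; []; _∷_; _++_; map; filter; length; cartesianProductWith)
import Data.List.Membership.DecPropositional as DecMembership
open import Data.List.Membership.Propositional using (_∈_; _∉_)
open import Data.List.Membership.Propositional.Properties
  using (∈-map⁻; ∈-++⁻; ∈-++⁺ʳ; ∈-filter⁻; ∈-cartesianProductWith⁻)
open import Data.List.Properties using (length-++; length-map; length-filter; map-++; map-∘; map-cong)
open import Data.List.Relation.Unary.Any using (here; there)
open import Data.Nat as ℕ using (ℕ; zero; suc; pred; NonZero; >-nonZero; z≤n; s≤s; _^_)
import Data.Nat.Properties as ℕ
open import Data.Nat.Tactic.RingSolver using (solve-∀)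
open import Data.Product using (∃-syntax; _×_; _,_; proj₂)
import Data.Rational as ℚ
import Data.Rational.Properties as ℚ
open import Data.Rational.Unnormalised using (mkℚᵘ)
import Data.Rational.Unnormalised as ℚᵘ
import Data.Rational.Unnormalised.Properties as ℚᵘ
open import Data.Sum using (_⊎_; inj₁; inj₂; [_,_]′)
open import Data.Vec using ([]; _∷_; zipWith) renaming (there to thereˢ)
import Data.Vec.Properties as Vec
open import Data.Vec.Relation.Binary.Pointwise.Extensional using (ext; Pointwise-≡⇒≡)
open import Function using (_∘_; it)
open import Level using (Level)
open import Relation.Binary.PropositionalEquality
open import Relation.Nullary using (Dec; yes; no; does; ¬_; contradiction)
open import Relation.Nullary.Decidable using (toSum)
import Relation.Unary as U

module Counting where

  open import Algebra.Properties.CommutativeSemigroup ℕ.*-commutativeSemigroup using (x∙yz≈y∙xz)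
  open import Data.Nat using (_+_; _*_; _≤_; _<_; _≟_; _/_; _%_)
  open import Data.Nat.Combinatorics using (_C_; nC1≡n; nCk+nC[k+1]≡[n+1]C[k+1])
  open import Data.Nat.DivMod using (m≡m%n+[m/n]*n; m%n<n; m/n*n≤m)
  open import Data.Nat.ListAction using (sum)
  open import Data.Nat.ListAction.Properties using (sum-++)
  open import Data.Nat.Properties
  open import Relation.Binary.Construct.Closure.ReflexiveTransitive using (Star; ε; _◅_; _◅◅_; reverse)

  private
    variable
      a p : Level
      A B : Set a
      n : ℕ

  -- Indicators and finite sums over lists.

  _∈?_ : (x : V n) (xs : List (V n)) → Dec (x ∈ xs)
  _∈?_ = DecMembership._∈?_ _≟ⱽ_

  𝟙 : {P : Set p} → Dec P → ℕ
  𝟙 P? = if does P? then 1 else 0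

  𝟙-mono : ∀ {q} {P : Set p} {Q : Set q} (P? : Dec P) (Q? : Dec Q) → (P → Q) → 𝟙 P? ≤ 𝟙 Q?
  𝟙-mono (no _)  _       _   = z≤n
  𝟙-mono (yes _) (yes _) _   = ≤-refl
  𝟙-mono (yes x) (no ¬y) p⇒q = contradiction (p⇒q x) ¬y

  𝟙-≤ : {P : Set p} (P? : Dec P) {m : ℕ} → (P → 1 ≤ m) → 𝟙 P? ≤ m
  𝟙-≤ (no _)  _   = z≤n
  𝟙-≤ (yes x) 1≤m = 1≤m x

  𝟙-false : {P : Set p} (P? : Dec P) → ¬ P → 𝟙 P? ≡ 0
  𝟙-false (no _)  _  = refl
  𝟙-false (yes x) ¬x = contradiction x ¬x

  𝟙-true : {P : Set p} (P? : Dec P) → P → 𝟙 P? ≡ 1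
  𝟙-true (no ¬x) x = contradiction x ¬x
  𝟙-true (yes _) _ = refl

  ∑ : List A → (A → ℕ) → ℕ
  ∑ xs f = sum (map f xs)

  ∑-cong : (xs : List A) {f g : A → ℕ} → (∀ x → f x ≡ g x) → ∑ xs f ≡ ∑ xs g
  ∑-cong xs f≡g = cong sum (map-cong f≡g xs)

  ∑-mono-∈ : (xs : List A) {f g : A → ℕ} → (∀ {x} → x ∈ xs → f x ≤ g x) → ∑ xs f ≤ ∑ xs g
  ∑-mono-∈ []       _   = z≤n
  ∑-mono-∈ (x ∷ xs) f≤g = +-mono-≤ (f≤g (here refl)) (∑-mono-∈ xs (f≤g ∘ there))

  ∑-mono : (xs : List A) {f g : A → ℕ} → (∀ x → f x ≤ g x) → ∑ xs f ≤ ∑ xs g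
  ∑-mono xs f≤g = ∑-mono-∈ xs (λ {x} _ → f≤g x)

  ∑-map : (h : A → B) (xs : List A) (f : B → ℕ) → ∑ (map h xs) f ≡ ∑ xs (f ∘ h)
  ∑-map h xs f = cong sum (sym (map-∘ xs))

  ∑-++ : (xs ys : List A) (f : A → ℕ) → ∑ (xs ++ ys) f ≡ ∑ xs f + ∑ ys f
  ∑-++ xs ys f = trans (cong sum (map-++ f xs ys)) (sum-++ (map f xs) (map f ys))

  ∑-+ : (xs : List A) (f g : A → ℕ) → ∑ xs (λ x → f x + g x) ≡ ∑ xs f + ∑ xs g
  ∑-+ []       f g = refl
  ∑-+ (x ∷ xs) f g rewrite ∑-+ xs f g = interchange (f x) (g x) (∑ xs f) (∑ xs g)
    where
    interchange : ∀ a b c d → a + b + (c + d) ≡ a + c + (b + d)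
    interchange = solve-∀

  ∑-*ˡ : (xs : List A) (c : ℕ) (f : A → ℕ) → ∑ xs (λ x → c * f x) ≡ c * ∑ xs f
  ∑-*ˡ []       c f = sym (*-zeroʳ c)
  ∑-*ˡ (x ∷ xs) c f rewrite ∑-*ˡ xs c f = sym (*-distribˡ-+ c (f x) (∑ xs f))

  ∑-const : (xs : List A) (c : ℕ) → ∑ xs (λ _ → c) ≡ length xs * c
  ∑-const []       c = refl
  ∑-const (x ∷ xs) c = cong (c +_) (∑-const xs c)

  ∑-zero : (xs : List A) {f : A → ℕ} → (∀ x → f x ≡ 0) → ∑ xs f ≡ 0
  ∑-zero xs f≡0 = trans (∑-cong xs f≡0) (trans (∑-const xs 0) (*-zeroʳ (length xs)))

  ∑-swap : (xs : List A) (ys : List B) (f : A → B → ℕ) →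
           ∑ xs (λ x → ∑ ys (f x)) ≡ ∑ ys (λ y → ∑ xs (λ x → f x y))
  ∑-swap []       ys f = sym (∑-zero ys (λ _ → refl))
  ∑-swap (x ∷ xs) ys f =
    trans (cong (∑ ys (f x) +_) (∑-swap xs ys f)) (sym (∑-+ ys (f x) (λ y → ∑ xs (λ x → f x y))))

  ∑-bound : (xs : List A) (f : A → ℕ) (M : ℕ) → (∀ {x} → x ∈ xs → f x ≤ M) → ∑ xs f ≤ length xs * M
  ∑-bound xs f M f≤M = ≤-trans (∑-mono-∈ xs f≤M) (≤-reflexive (∑-const xs M))

  -- A vanishing term saves one summand. Applied to the step back along an orbit, this is what
  -- lowers the factor `d` to `pred d` in each step of `∑-escape`.
  ∑-bound-zero : (xs : List A) (f : A → ℕ) (M : ℕ) → (∀ {x} → x ∈ xs → f x ≤ M) →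
                 ∀ {z} → z ∈ xs → f z ≡ 0 → ∑ xs f ≤ pred (length xs) * M
  ∑-bound-zero (x ∷ xs) f M f≤M (here refl) fz≡0 rewrite fz≡0 = ∑-bound xs f M (f≤M ∘ there)
  ∑-bound-zero (x ∷ xs@(_ ∷ _)) f M f≤M (there z∈) fz≡0 =
    +-mono-≤ (f≤M (here refl)) (∑-bound-zero xs f M (f≤M ∘ there) z∈ fz≡0)

  length-filter-∑ : {P : U.Pred A p} (P? : U.Decidable P) (xs : List A) →
                    length (filter P? xs) ≡ ∑ xs (𝟙 ∘ P?)
  length-filter-∑ P? []       = refl
  length-filter-∑ P? (x ∷ xs) with does (P? x)
  ... | true  = cong suc (length-filter-∑ P? xs)
  ... | false = length-filter-∑ P? xs

  ∑-cartesianProductWith : ∀ {C : Set a} (h : A → B → C) (xs : List A) (ys : List B) (f : C → ℕ) →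
    ∑ (cartesianProductWith h xs ys) f ≡ ∑ xs (λ x → ∑ ys (λ y → f (h x y)))
  ∑-cartesianProductWith h []       ys f = refl
  ∑-cartesianProductWith h (x ∷ xs) ys f =
    trans (∑-++ (map (h x) ys) _ f) (cong₂ _+_ (∑-map (h x) ys f) (∑-cartesianProductWith h xs ys f))

  -- Counting vertices, `k`-subsets and members of a list.

  length-vertices : ∀ n → length (vertices n) ≡ 2 ^ n
  length-vertices zero    = refl
  length-vertices (suc n) = begin
    length (map (false ∷_) (vertices n) ++ map (true ∷_) (vertices n))
      ≡⟨ length-++ (map (false ∷_) (vertices n)) ⟩
    length (map (false ∷_) (vertices n)) + length (map (true ∷_) (vertices n))
      ≡⟨ cong₂ _+_ (length-map _ (vertices n)) (length-map _ (vertices n)) ⟩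
    length (vertices n) + length (vertices n)
      ≡⟨ cong₂ _+_ (length-vertices n) (trans (length-vertices n) (sym (+-identityʳ (2 ^ n)))) ⟩
    2 ^ suc n ∎
    where open ≡-Reasoning

  ∑-vertices-suc : ∀ n (f : V (suc n) → ℕ) →
    ∑ (vertices (suc n)) f ≡ ∑ (vertices n) (f ∘ (false ∷_)) + ∑ (vertices n) (f ∘ (true ∷_))
  ∑-vertices-suc n f =
    trans (∑-++ (map (false ∷_) (vertices n)) _ f)
          (cong₂ _+_ (∑-map (false ∷_) (vertices n) f) (∑-map (true ∷_) (vertices n) f))

  -- Splitting off the first coordinate turns the count into Pascal's rule.
  length-kSubsets : ∀ n k → length (kSubsets n k) ≡ n C k
  length-kSubsets n k = trans (length-filter-∑ (λ s → ∣ s ∣ˢ ≟ k) (vertices n)) (count n k)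
    where
    count : ∀ n k → ∑ (vertices n) (λ s → 𝟙 (∣ s ∣ˢ ≟ k)) ≡ n C k
    count zero    zero    = refl
    count zero    (suc k) = refl
    count (suc n) zero    = begin
      ∑ (vertices (suc n)) (λ s → 𝟙 (∣ s ∣ˢ ≟ 0))
        ≡⟨ ∑-vertices-suc n _ ⟩
      ∑ (vertices n) (λ s → 𝟙 (∣ s ∣ˢ ≟ 0)) + ∑ (vertices n) (λ s → 𝟙 (suc ∣ s ∣ˢ ≟ 0))
        ≡⟨ cong₂ _+_ (count n 0) (∑-zero (vertices n) (λ _ → refl)) ⟩
      suc n C 0 ∎
      where open ≡-Reasoning
    count (suc n) (suc k) = begin
      ∑ (vertices (suc n)) (λ s → 𝟙 (∣ s ∣ˢ ≟ suc k))
        ≡⟨ ∑-vertices-suc n _ ⟩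
      ∑ (vertices n) (λ s → 𝟙 (∣ s ∣ˢ ≟ suc k)) + ∑ (vertices n) (λ s → 𝟙 (suc ∣ s ∣ˢ ≟ suc k))
        ≡⟨ cong₂ _+_ (count n (suc k)) (count n k) ⟩
      n C suc k + n C k
        ≡⟨ +-comm (n C suc k) (n C k) ⟩
      n C k + n C suc k
        ≡⟨ nCk+nC[k+1]≡[n+1]C[k+1] n k ⟩
      suc n C suc k ∎
      where open ≡-Reasoning

  ∑-𝟙-≟ : (y : V n) → ∑ (vertices n) (λ x → 𝟙 (x ≟ⱽ y)) ≤ 1
  ∑-𝟙-≟ []                      = ≤-refl
  ∑-𝟙-≟ {n = suc n} (false ∷ y) = begin
    ∑ (vertices (suc n)) (λ x → 𝟙 (x ≟ⱽ (false ∷ y)))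
      ≡⟨ ∑-vertices-suc n (λ x → 𝟙 (x ≟ⱽ (false ∷ y))) ⟩
    ∑ (vertices n) (λ x → 𝟙 ((false ∷ x) ≟ⱽ (false ∷ y))) + ∑ (vertices n) (λ x → 𝟙 ((true ∷ x) ≟ⱽ (false ∷ y)))
      ≤⟨ +-mono-≤ (∑-mono (vertices n) (λ x → 𝟙-mono ((false ∷ x) ≟ⱽ (false ∷ y)) (x ≟ⱽ y) Vec.∷-injectiveʳ))
                  (≤-reflexive (∑-zero (vertices n) (λ x → 𝟙-false ((true ∷ x) ≟ⱽ (false ∷ y)) λ ()))) ⟩
    ∑ (vertices n) (λ x → 𝟙 (x ≟ⱽ y)) + 0
      ≡⟨ +-identityʳ _ ⟩
    ∑ (vertices n) (λ x → 𝟙 (x ≟ⱽ y))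
      ≤⟨ ∑-𝟙-≟ y ⟩
    1 ∎
    where open ≤-Reasoning
  ∑-𝟙-≟ {n = suc n} (true ∷ y) = begin
    ∑ (vertices (suc n)) (λ x → 𝟙 (x ≟ⱽ (true ∷ y)))
      ≡⟨ ∑-vertices-suc n (λ x → 𝟙 (x ≟ⱽ (true ∷ y))) ⟩
    ∑ (vertices n) (λ x → 𝟙 ((false ∷ x) ≟ⱽ (true ∷ y))) + ∑ (vertices n) (λ x → 𝟙 ((true ∷ x) ≟ⱽ (true ∷ y)))
      ≤⟨ +-mono-≤ (≤-reflexive (∑-zero (vertices n) (λ x → 𝟙-false ((false ∷ x) ≟ⱽ (true ∷ y)) λ ())))
                  (∑-mono (vertices n) (λ x → 𝟙-mono ((true ∷ x) ≟ⱽ (true ∷ y)) (x ≟ⱽ y) Vec.∷-injectiveʳ)) ⟩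
    ∑ (vertices n) (λ x → 𝟙 (x ≟ⱽ y))
      ≤⟨ ∑-𝟙-≟ y ⟩
    1 ∎
    where open ≤-Reasoning

  ∑-𝟙-∈ : (S : List (V n)) → ∑ (vertices n) (λ x → 𝟙 (x ∈? S)) ≤ length S
  ∑-𝟙-∈ {n = n} []      = ≤-reflexive (∑-zero (vertices n) (λ _ → refl))
  ∑-𝟙-∈ {n = n} (y ∷ S) = begin
    ∑ (vertices n) (λ x → 𝟙 (x ∈? (y ∷ S)))
      ≤⟨ ∑-mono (vertices n) 𝟙-∈-∷ ⟩
    ∑ (vertices n) (λ x → 𝟙 (x ≟ⱽ y) + 𝟙 (x ∈? S))
      ≡⟨ ∑-+ (vertices n) _ _ ⟩
    ∑ (vertices n) (λ x → 𝟙 (x ≟ⱽ y)) + ∑ (vertices n) (λ x → 𝟙 (x ∈? S))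
      ≤⟨ +-mono-≤ (∑-𝟙-≟ y) (∑-𝟙-∈ S) ⟩
    suc (length S) ∎
    where
    open ≤-Reasoning
    𝟙-∈-∷ : ∀ x → 𝟙 (x ∈? (y ∷ S)) ≤ 𝟙 (x ≟ⱽ y) + 𝟙 (x ∈? S)
    𝟙-∈-∷ x with does (x ≟ⱽ y)
    ... | true  = s≤s z≤n
    ... | false = ≤-refl

  -- Translations of the cube.

  infixl 6 _⊕_

  -- For a singleton s = {i}, v ⊕ s is the neighbour of v in direction i.
  _⊕_ : V n → Subset n → V n
  _⊕_ = zipWith _xor_

  ⊕-involutive : (v : V n) (s : Subset n) → (v ⊕ s) ⊕ s ≡ v
  ⊕-involutive []      []      = refl
  ⊕-involutive (b ∷ v) (c ∷ s) = cong₂ _∷_ (xor-involutive b c) (⊕-involutive v s)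
    where
    xor-involutive : ∀ b c → (b xor c) xor c ≡ b
    xor-involutive b c = trans (Bool.xor-assoc b c c)
      (trans (cong (b xor_) (Bool.xor-same c)) (Bool.xor-identityʳ b))

  -- Translation by `s` permutes the cube: coordinate by coordinate, a `true` in `s` exchanges the
  -- two halves. Hence the uniform measure is stationary for the simple random walk.
  ∑-vertices-⊕ : (s : Subset n) (f : V n → ℕ) → ∑ (vertices n) (λ v → f (v ⊕ s)) ≡ ∑ (vertices n) f
  ∑-vertices-⊕ []                      f = refl
  ∑-vertices-⊕ {n = suc n} (false ∷ s) f = begin
    ∑ (vertices (suc n)) (λ v → f (v ⊕ (false ∷ s)))
      ≡⟨ ∑-vertices-suc n _ ⟩
    ∑ (vertices n) (λ v → f (false ∷ (v ⊕ s))) + ∑ (vertices n) (λ v → f (true ∷ (v ⊕ s)))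
      ≡⟨ cong₂ _+_ (∑-vertices-⊕ s (f ∘ (false ∷_))) (∑-vertices-⊕ s (f ∘ (true ∷_))) ⟩
    ∑ (vertices n) (f ∘ (false ∷_)) + ∑ (vertices n) (f ∘ (true ∷_))
      ≡⟨ ∑-vertices-suc n f ⟨
    ∑ (vertices (suc n)) f ∎
    where open ≡-Reasoning
  ∑-vertices-⊕ {n = suc n} (true ∷ s) f = begin
    ∑ (vertices (suc n)) (λ v → f (v ⊕ (true ∷ s)))
      ≡⟨ ∑-vertices-suc n _ ⟩
    ∑ (vertices n) (λ v → f (true ∷ (v ⊕ s))) + ∑ (vertices n) (λ v → f (false ∷ (v ⊕ s)))
      ≡⟨ cong₂ _+_ (∑-vertices-⊕ s (f ∘ (true ∷_))) (∑-vertices-⊕ s (f ∘ (false ∷_))) ⟩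
    ∑ (vertices n) (f ∘ (true ∷_)) + ∑ (vertices n) (f ∘ (false ∷_))
      ≡⟨ +-comm (∑ (vertices n) (f ∘ (true ∷_))) _ ⟩
    ∑ (vertices n) (f ∘ (false ∷_)) + ∑ (vertices n) (f ∘ (true ∷_))
      ≡⟨ ∑-vertices-suc n f ⟨
    ∑ (vertices (suc n)) f ∎
    where open ≡-Reasoning

  -- Independence of the choices at different vertices.

  ∈-allMaps⁻ : ∀ n {xs : List A} {ω : V n → A} → ω ∈ allMaps n xs → ∀ v → ω v ∈ xs
  ∈-allMaps⁻ zero ω∈ v with ∈-map⁻ _ ω∈
  ... | _ , x∈ , refl = x∈
  ∈-allMaps⁻ (suc n) {xs} ω∈ v
    with ∈-cartesianProductWith⁻ glue (allMaps n xs) (allMaps n xs) ω∈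
  ∈-allMaps⁻ (suc n) ω∈ (false ∷ v) | _ , _ , f∈ , g∈ , refl = ∈-allMaps⁻ n f∈ v
  ∈-allMaps⁻ (suc n) ω∈ (true  ∷ v) | _ , _ , f∈ , g∈ , refl = ∈-allMaps⁻ n g∈ v

  AgreeOff : (V n → Set p) → (ω ω′ : V n → A) → Set _
  AgreeOff P ω ω′ = ∀ y → ¬ P y → ω y ≡ ω′ y

  -- Independence: if F s does not look at the value at x, the value at x may be
  -- averaged over separately.
  ∑-allMaps-resample : ∀ n (xs : List A) (x : V n) (F : A → (V n → A) → ℕ) →
    (∀ s {ω ω′} → AgreeOff (_≡ x) ω ω′ → F s ω ≡ F s ω′) →
    length xs * ∑ (allMaps n xs) (λ ω → F (ω x) ω) ≡ ∑ xs (λ s → ∑ (allMaps n xs) (F s))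
  ∑-allMaps-resample zero xs [] F local = begin
    length xs * ∑ (map (λ a _ → a) xs) (λ ω → F (ω []) ω)
      ≡⟨ cong (length xs *_) (∑-map (λ a _ → a) xs _) ⟩
    length xs * ∑ xs (λ a → F a (λ _ → a))
      ≡⟨ ∑-*ˡ xs (length xs) _ ⟨
    ∑ xs (λ a → length xs * F a (λ _ → a))
      ≡⟨ ∑-cong xs (λ a → sym (∑-const xs (F a (λ _ → a)))) ⟩
    ∑ xs (λ a → ∑ xs (λ _ → F a (λ _ → a)))
      ≡⟨ ∑-cong xs (λ a → ∑-cong xs (λ b → local a λ { [] y≢ → contradiction refl y≢ })) ⟩
    ∑ xs (λ a → ∑ xs (λ b → F a (λ _ → b)))
      ≡⟨ ∑-cong xs (λ a → sym (∑-map (λ b _ → b) xs (F a))) ⟩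
    ∑ xs (λ a → ∑ (map (λ b _ → b) xs) (F a)) ∎
    where open ≡-Reasoning
  ∑-allMaps-resample (suc n) xs (false ∷ x) F local = begin
    length xs * ∑ (allMaps (suc n) xs) (λ ω → F (ω (false ∷ x)) ω)
      ≡⟨ cong (length xs *_) (trans (∑-cartesianProductWith glue M M _) (∑-swap M M _)) ⟩
    length xs * ∑ M (λ g → ∑ M (λ f → F (f x) (glue f g)))
      ≡⟨ ∑-*ˡ M (length xs) _ ⟨
    ∑ M (λ g → length xs * ∑ M (λ f → F (f x) (glue f g)))
      ≡⟨ ∑-cong M (λ g → ∑-allMaps-resample n xs x (λ s f → F s (glue f g)) (λ s e → local s (agree e))) ⟩
    ∑ M (λ g → ∑ xs (λ s → ∑ M (λ f → F s (glue f g))))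
      ≡⟨ ∑-swap M xs _ ⟩
    ∑ xs (λ s → ∑ M (λ g → ∑ M (λ f → F s (glue f g))))
      ≡⟨ ∑-cong xs (λ s → trans (∑-swap M M _) (sym (∑-cartesianProductWith glue M M (F s)))) ⟩
    ∑ xs (λ s → ∑ (allMaps (suc n) xs) (F s)) ∎
    where
    open ≡-Reasoning
    M = allMaps n xs
    agree : ∀ {f f′ g} → AgreeOff (_≡ x) f f′ → AgreeOff (_≡ false ∷ x) (glue f g) (glue f′ g)
    agree e (false ∷ y) y≢ = e y (y≢ ∘ cong (false ∷_))
    agree e (true  ∷ y) y≢ = refl
  ∑-allMaps-resample (suc n) xs (true ∷ x) F local = begin
    length xs * ∑ (allMaps (suc n) xs) (λ ω → F (ω (true ∷ x)) ω)
      ≡⟨ cong (length xs *_) (∑-cartesianProductWith glue M M _) ⟩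
    length xs * ∑ M (λ f → ∑ M (λ g → F (g x) (glue f g)))
      ≡⟨ ∑-*ˡ M (length xs) _ ⟨
    ∑ M (λ f → length xs * ∑ M (λ g → F (g x) (glue f g)))
      ≡⟨ ∑-cong M (λ f → ∑-allMaps-resample n xs x (λ s g → F s (glue f g)) (λ s e → local s (agree e))) ⟩
    ∑ M (λ f → ∑ xs (λ s → ∑ M (λ g → F s (glue f g))))
      ≡⟨ ∑-swap M xs _ ⟩
    ∑ xs (λ s → ∑ M (λ f → ∑ M (λ g → F s (glue f g))))
      ≡⟨ ∑-cong xs (λ s → sym (∑-cartesianProductWith glue M M (F s))) ⟩
    ∑ xs (λ s → ∑ (allMaps (suc n) xs) (F s)) ∎
    where
    open ≡-Reasoning
    M = allMaps n xs
    agree : ∀ {f g g′} → AgreeOff (_≡ x) g g′ → AgreeOff (_≡ true ∷ x) (glue f g) (glue f g′)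
    agree e (false ∷ y) y≢ = refl
    agree e (true  ∷ y) y≢ = e y (y≢ ∘ cong (true ∷_))

  -- Orbits exposed step by step.

  next : Choice n → V n → V n
  next ω v = v ⊕ ω v

  -- A form of independence: `P` is the set of vertices already exposed, and a local `f` depends
  -- only on the choices at the other vertices.
  Local : (V n → Set p) → (Choice n → ℕ) → Set p
  Local P f = ∀ {ω ω′} → AgreeOff P ω ω′ → f ω ≡ f ω′

  module _ (result : List (V n) → V n → Choice n → ℕ) (timeout : ℕ) where

    -- `T` collects the vertices whose choices have been read, and `l` bounds the number of further
    -- readings. A return to `T` ends the walk with `result`, so every step that is made uses a
    -- fresh choice.
    walk : ℕ → List (V n) → V n → Choice n → ℕ
    walk l T x ω with x ∈? T
    walk l       T x ω | yes _ = result T x ω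
    walk zero    T x ω | no _  = timeout
    walk (suc l) T x ω | no _  = walk l (x ∷ T) (next ω x) ω

    walk-∈ : ∀ l {T x} → x ∈ T → ∀ ω → walk l T x ω ≡ result T x ω
    walk-∈ l {T} {x} x∈T ω with x ∈? T
    ... | yes _  = refl
    ... | no x∉T = contradiction x∈T x∉T

    walk-zero : ∀ {T x} → x ∉ T → ∀ ω → walk zero T x ω ≡ timeout
    walk-zero {T} {x} x∉T ω with x ∈? T
    ... | yes x∈T = contradiction x∈T x∉T
    ... | no _    = refl

    walk-suc : ∀ l {T x} → x ∉ T → ∀ ω → walk (suc l) T x ω ≡ walk l (x ∷ T) (next ω x) ω
    walk-suc l {T} {x} x∉T ω with x ∈? T
    ... | yes x∈T = contradiction x∈T x∉T
    ... | no _    = refl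

    module _ (result-local : ∀ T x → Local (_∈ T) (result T x)) where

      -- A vertex joins the visited list at the moment its choice is read, so the rest of the walk
      -- never consults a choice made in `T`.
      walk-local : ∀ l T x → Local (_∈ T) (walk l T x)
      walk-local l T x e with x ∈? T
      walk-local l       T x e | yes _  = result-local T x e
      walk-local zero    T x e | no _   = refl
      walk-local (suc l) T x {ω} {ω′} e | no x∉T rewrite e x x∉T =
        walk-local l (x ∷ T) (x ⊕ ω′ x) (λ y y∉ → e y (y∉ ∘ there))

      -- The Markov property: after the first step the walk ignores the choice at `x`, so this
      -- choice can be averaged over separately by `∑-allMaps-resample`.
      ∑-walk-suc : ∀ (xs : List (Subset n)) l {T x} → x ∉ T →
        length xs * ∑ (allMaps n xs) (walk (suc l) T x) ≡
        ∑ xs (λ s → ∑ (allMaps n xs) (walk l (x ∷ T) (x ⊕ s)))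
      ∑-walk-suc xs l {T} {x} x∉T =
        trans (cong (length xs *_) (∑-cong (allMaps n xs) (walk-suc l x∉T)))
              (∑-allMaps-resample n xs x (λ s → walk l (x ∷ T) (x ⊕ s))
                (λ s e → walk-local l (x ∷ T) (x ⊕ s) (λ y y∉ → e y (y∉ ∘ here))))

  -- The indicator that the first `suc l` vertices of the orbit of `x`, counting `x` itself, are
  -- distinct and outside `T`.
  escape : ℕ → List (V n) → V n → Choice n → ℕ
  escape = walk (λ _ _ _ → 0) 1

  -- The initial set of visited vertices is to contain S, so that the walk stops
  -- as soon as it reaches S.
  hit : List (V n) → ℕ → List (V n) → V n → Choice n → ℕ
  hit S = walk (λ _ x _ → 𝟙 (x ∈? S)) 0

  -- First the orbit T of x is exposed until it closes up, then one counts the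
  -- vertices from which T is reached within m steps.
  meet : ℕ → ℕ → List (V n) → V n → Choice n → ℕ
  meet {n} m = walk (λ T _ ω → ∑ (vertices n) (λ v → hit T m T v ω)) 0

  hit-local : ∀ S l (T : List (V n)) x → Local (_∈ T) (hit S l T x)
  hit-local S = walk-local _ _ (λ _ _ _ → refl)

  -- `T` is at once the target and the initial visited set of `hit`, so counting the vertices that
  -- reach `T` reads no choice already exposed along the first orbit.
  meet-result-local : ∀ m (T : List (V n)) → V n → Local (_∈ T) (λ ω → ∑ (vertices n) (λ v → hit T m T v ω))
  meet-result-local m T _ e = ∑-cong (vertices _) (λ v → hit-local T m T v e)

  -- Expectations of `escape`, `hit` and `meet`.

  ^-suc-* : ∀ d l m → d ^ suc l * m ≡ d ^ l * (d * m)
  ^-suc-* d l m = trans (cong (_* m) (*-comm d (d ^ l))) (*-assoc (d ^ l) d m)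

  module _ (xs : List (Subset n)) where

    private
      Ω = allMaps n xs
      d = length xs

    -- The step back to the previous vertex, which has probability 1/d, closes
    -- the orbit.
    ∑-escape : ∀ l {T x s} → s ∈ xs → x ⊕ s ∈ T →
               d ^ l * ∑ Ω (escape l T x) ≤ length Ω * pred d ^ l
    ∑-escape l {T} {x} s∈ p∈T with toSum (x ∈? T)
    ... | inj₁ x∈T = ≤-trans (≤-reflexive
      (trans (cong (d ^ l *_) (∑-zero Ω (walk-∈ _ _ l x∈T))) (*-zeroʳ (d ^ l)))) z≤n
    ∑-escape zero {T} {x} s∈ p∈T | inj₂ x∉T = ≤-reflexive (begin
      1 * ∑ Ω (escape 0 T x) ≡⟨ *-identityˡ _ ⟩
      ∑ Ω (escape 0 T x)     ≡⟨ ∑-cong Ω (walk-zero _ _ x∉T) ⟩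
      ∑ Ω (λ _ → 1)          ≡⟨ ∑-const Ω 1 ⟩
      length Ω * 1           ∎)
      where open ≡-Reasoning
    ∑-escape (suc l) {T} {x} {s₀} s₀∈ p∈T | inj₂ x∉T = begin
      d ^ suc l * ∑ Ω (escape (suc l) T x)
        ≡⟨ ^-suc-* d l _ ⟩
      d ^ l * (d * ∑ Ω (escape (suc l) T x))
        ≡⟨ cong (d ^ l *_) (∑-walk-suc _ _ (λ _ _ _ → refl) xs l x∉T) ⟩
      d ^ l * ∑ xs (λ s → ∑ Ω (escape l (x ∷ T) (x ⊕ s)))
        ≡⟨ ∑-*ˡ xs (d ^ l) _ ⟨
      ∑ xs (λ s → d ^ l * ∑ Ω (escape l (x ∷ T) (x ⊕ s)))
        ≤⟨ ∑-bound-zero xs _ (length Ω * pred d ^ l)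
             (λ {s} s∈ → ∑-escape l s∈ (here (⊕-involutive x s)))
             s₀∈ (trans (cong (d ^ l *_) (∑-zero Ω (walk-∈ _ _ l (there p∈T)))) (*-zeroʳ (d ^ l))) ⟩
      pred d * (length Ω * pred d ^ l)
        ≡⟨ x∙yz≈y∙xz (pred d) (length Ω) (pred d ^ l) ⟩
      length Ω * pred d ^ suc l ∎
      where open ≤-Reasoning

    -- The first step has no previous vertex to return to, so it contributes a factor `d`, and only
    -- the `l` later steps contribute `pred d`.
    ∑-escape-start : ∀ l (x : V n) → d ^ suc l * ∑ Ω (escape (suc l) [] x) ≤ d * (length Ω * pred d ^ l)
    ∑-escape-start l x = begin
      d ^ suc l * ∑ Ω (escape (suc l) [] x)
        ≡⟨ ^-suc-* d l _ ⟩
      d ^ l * (d * ∑ Ω (escape (suc l) [] x))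
        ≡⟨ cong (d ^ l *_) (∑-walk-suc _ 1 (λ _ _ _ → refl) xs l {[]} {x} (λ ())) ⟩
      d ^ l * ∑ xs (λ s → ∑ Ω (escape l (x ∷ []) (x ⊕ s)))
        ≡⟨ ∑-*ˡ xs (d ^ l) _ ⟨
      ∑ xs (λ s → d ^ l * ∑ Ω (escape l (x ∷ []) (x ⊕ s)))
        ≤⟨ ∑-bound xs _ _ (λ {s} s∈ → ∑-escape l s∈ (here (⊕-involutive x s))) ⟩
      d * (length Ω * pred d ^ l) ∎
      where open ≤-Reasoning

    module _ (S : List (V n)) where

      -- d ^ l times the expected number of visits to S during the first l steps
      -- of the simple random walk from x.
      visits : ℕ → V n → ℕ
      visits zero    x = 𝟙 (x ∈? S)
      visits (suc l) x = d ^ suc l * 𝟙 (x ∈? S) + ∑ xs (λ s → visits l (x ⊕ s))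

      visits-start : ∀ l x → d ^ l * 𝟙 (x ∈? S) ≤ visits l x
      visits-start zero    x = ≤-reflexive (*-identityˡ _)
      visits-start (suc l) x = m≤m+n _ _

      -- Every translation preserves the sum over all starting points, so each of the times `0` to
      -- `l` contributes at most `d ^ l * length S`.
      ∑-visits : ∀ l → ∑ (vertices n) (visits l) ≤ d ^ l * (suc l * length S)
      ∑-visits zero    = ≤-trans (∑-𝟙-∈ S) (≤-reflexive (base (length S)))
        where
        base : ∀ a → a ≡ 1 * (1 * a)
        base = solve-∀
      ∑-visits (suc l) = begin
        ∑ (vertices n) (visits (suc l))
          ≡⟨ ∑-+ (vertices n) _ _ ⟩
        ∑ (vertices n) (λ x → d ^ suc l * 𝟙 (x ∈? S)) + ∑ (vertices n) (λ x → ∑ xs (λ s → visits l (x ⊕ s)))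
          ≡⟨ cong₂ _+_ (∑-*ˡ (vertices n) (d ^ suc l) _) (∑-swap (vertices n) xs _) ⟩
        d ^ suc l * ∑ (vertices n) (λ x → 𝟙 (x ∈? S)) + ∑ xs (λ s → ∑ (vertices n) (λ x → visits l (x ⊕ s)))
          ≤⟨ +-mono-≤ (*-monoʳ-≤ (d ^ suc l) (∑-𝟙-∈ S))
                      (∑-bound xs _ _ (λ {s} _ → ≤-trans (≤-reflexive (∑-vertices-⊕ s (visits l))) (∑-visits l))) ⟩
        d ^ suc l * length S + d * (d ^ l * (suc l * length S))
          ≡⟨ step d (d ^ l) l (length S) ⟩
        d ^ suc l * (suc (suc l) * length S) ∎
        where
        open ≤-Reasoning
        step : ∀ d e l k → d * e * k + d * (e * (suc l * k)) ≡ d * e * (suc (suc l) * k)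
        step = solve-∀

      -- As long as it finds fresh vertices, the orbit moves like the simple random walk. Stopping
      -- in `S` is one of the visits counted by `visits`, and whatever the random walk does
      -- afterwards only enlarges the right-hand side.
      ∑-hit : ∀ l T x → d ^ l * ∑ Ω (hit S l T x) ≤ length Ω * visits l x
      ∑-hit l T x with toSum (x ∈? T)
      ... | inj₁ x∈T = begin
        d ^ l * ∑ Ω (hit S l T x)           ≡⟨ cong (d ^ l *_) (∑-cong Ω (walk-∈ _ _ l x∈T)) ⟩
        d ^ l * ∑ Ω (λ _ → 𝟙 (x ∈? S))      ≡⟨ cong (d ^ l *_) (∑-const Ω _) ⟩
        d ^ l * (length Ω * 𝟙 (x ∈? S))     ≡⟨ x∙yz≈y∙xz (d ^ l) (length Ω) _ ⟩
        length Ω * (d ^ l * 𝟙 (x ∈? S))     ≤⟨ *-monoʳ-≤ (length Ω) (visits-start l x) ⟩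
        length Ω * visits l x               ∎
        where open ≤-Reasoning
      ∑-hit zero T x | inj₂ x∉T = ≤-trans (≤-reflexive
        (trans (*-identityˡ _) (∑-zero Ω (walk-zero _ _ x∉T)))) z≤n
      ∑-hit (suc l) T x | inj₂ x∉T = begin
        d ^ suc l * ∑ Ω (hit S (suc l) T x)
          ≡⟨ ^-suc-* d l _ ⟩
        d ^ l * (d * ∑ Ω (hit S (suc l) T x))
          ≡⟨ cong (d ^ l *_) (∑-walk-suc _ _ (λ _ _ _ → refl) xs l x∉T) ⟩
        d ^ l * ∑ xs (λ s → ∑ Ω (hit S l (x ∷ T) (x ⊕ s)))
          ≡⟨ ∑-*ˡ xs (d ^ l) _ ⟨
        ∑ xs (λ s → d ^ l * ∑ Ω (hit S l (x ∷ T) (x ⊕ s)))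
          ≤⟨ ∑-mono xs (λ s → ∑-hit l (x ∷ T) (x ⊕ s)) ⟩
        ∑ xs (λ s → length Ω * visits l (x ⊕ s))
          ≡⟨ ∑-*ˡ xs (length Ω) _ ⟩
        length Ω * ∑ xs (λ s → visits l (x ⊕ s))
          ≤⟨ *-monoʳ-≤ (length Ω) (m≤n+m _ (d ^ suc l * 𝟙 (x ∈? S))) ⟩
        length Ω * visits (suc l) x ∎
        where open ≤-Reasoning

    module _ .{{_ : NonZero d}} where

      ∑-∑-hit : ∀ S l → ∑ Ω (λ ω → ∑ (vertices n) (λ v → hit S l S v ω)) ≤ length Ω * (suc l * length S)
      ∑-∑-hit S l = *-cancelˡ-≤ (d ^ l) {{m^n≢0 d l}} (begin
        d ^ l * ∑ Ω (λ ω → ∑ (vertices n) (λ v → hit S l S v ω))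
          ≡⟨ cong (d ^ l *_) (∑-swap Ω (vertices n) _) ⟩
        d ^ l * ∑ (vertices n) (λ v → ∑ Ω (hit S l S v))
          ≡⟨ ∑-*ˡ (vertices n) (d ^ l) _ ⟨
        ∑ (vertices n) (λ v → d ^ l * ∑ Ω (hit S l S v))
          ≤⟨ ∑-mono (vertices n) (∑-hit S l S) ⟩
        ∑ (vertices n) (λ v → length Ω * visits S l v)
          ≡⟨ ∑-*ˡ (vertices n) (length Ω) _ ⟩
        length Ω * ∑ (vertices n) (visits S l)
          ≤⟨ *-monoʳ-≤ (length Ω) (∑-visits S l) ⟩
        length Ω * (d ^ l * (suc l * length S))
          ≡⟨ x∙yz≈y∙xz (length Ω) (d ^ l) _ ⟩
        d ^ l * (length Ω * (suc l * length S)) ∎)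
        where open ≤-Reasoning

      -- The recursion averages over the choices read along the first orbit, which adds at most `l`
      -- vertices to `T`. Once the orbit closes up, an average over `Ω` with `T` fixed remains, and
      -- `∑-∑-hit` bounds it; a timeout contributes 0.
      ∑-meet : ∀ m l T x → ∑ Ω (meet m l T x) ≤ length Ω * (suc m * (length T + l))
      ∑-meet m l T x with toSum (x ∈? T)
      ... | inj₁ x∈T = begin
        ∑ Ω (meet m l T x)
          ≡⟨ ∑-cong Ω (walk-∈ _ _ l x∈T) ⟩
        ∑ Ω (λ ω → ∑ (vertices n) (λ v → hit T m T v ω))
          ≤⟨ ∑-∑-hit T m ⟩
        length Ω * (suc m * length T)
          ≤⟨ *-monoʳ-≤ (length Ω) (*-monoʳ-≤ (suc m) (m≤m+n _ l)) ⟩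
        length Ω * (suc m * (length T + l)) ∎
        where open ≤-Reasoning
      ∑-meet m zero T x | inj₂ x∉T = ≤-trans (≤-reflexive (∑-zero Ω (walk-zero _ _ x∉T))) z≤n
      ∑-meet m (suc l) T x | inj₂ x∉T = *-cancelˡ-≤ d (begin
        d * ∑ Ω (meet m (suc l) T x)
          ≡⟨ ∑-walk-suc _ _ (meet-result-local m) xs l x∉T ⟩
        ∑ xs (λ s → ∑ Ω (meet m l (x ∷ T) (x ⊕ s)))
          ≤⟨ ∑-bound xs _ _ (λ {s} _ → ∑-meet m l (x ∷ T) (x ⊕ s)) ⟩
        d * (length Ω * (suc m * (suc (length T) + l)))
          ≡⟨ cong (λ k → d * (length Ω * (suc m * k))) (sym (+-suc (length T) l)) ⟩
        d * (length Ω * (suc m * (length T + suc l))) ∎)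
        where open ≤-Reasoning

  -- Orbits of a fixed choice.

  ∈-∷⁻ : {x y : V n} {T : List (V n)} → x ∈ T → y ∈ x ∷ T → y ∈ T
  ∈-∷⁻ x∈T (here refl) = x∈T
  ∈-∷⁻ _   (there y∈T) = y∈T

  infix 4 _⊢_↠_

  _⊢_↠_ : Choice n → V n → V n → Set
  ω ⊢ u ↠ v = Star (λ x y → y ≡ next ω x) u v

  closed-↠ : ∀ {ω : Choice n} {P : V n → Set} → (∀ {y} → P y → P (next ω y)) →
             ∀ {y w} → ω ⊢ y ↠ w → P y → P w
  closed-↠ closed ε          py = py
  closed-↠ closed (refl ◅ r) py = closed-↠ closed r (closed py)

  module _ (ω : Choice n) where

    -- T is an initial part of an orbit, which continues with x.
    Traced : List (V n) → V n → Set
    Traced T x = ∀ {y} → y ∈ T → next ω y ∈ x ∷ T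

    traced-next : ∀ {T x} → Traced T x → Traced (x ∷ T) (next ω x)
    traced-next tr (here refl) = here refl
    traced-next tr (there y∈T) = there (tr y∈T)

    traced-closed : ∀ {T x} → Traced T x → x ∈ T → ∀ {y} → y ∈ T → next ω y ∈ T
    traced-closed tr x∈T y∈T = ∈-∷⁻ x∈T (tr y∈T)

    -- The orbit cannot close up inside `T` before it reaches `S`: then `T` would be closed under
    -- `next ω` and contain `w`, although it is disjoint from `S`. So it either reaches `S` in time
    -- or is still on fresh vertices when `l` runs out.
    escape⊎hit : ∀ l {S w} T x → w ∈ S → ω ⊢ x ↠ w → Traced T x → (∀ {y} → y ∈ T → y ∉ S) →
                 1 ≤ escape l T x ω + hit S l (T ++ S) x ω
    escape⊎hit l {S} T x w∈S r tr disj with toSum (x ∈? S)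
    ... | inj₁ x∈S =
      ≤-trans (≤-reflexive (sym (trans (walk-∈ _ _ l (∈-++⁺ʳ T x∈S) ω) (𝟙-true (x ∈? S) x∈S))))
              (m≤n+m _ (escape l T x ω))
    ... | inj₂ x∉S with toSum (x ∈? T)
    ...   | inj₁ x∈T = contradiction w∈S (disj (closed-↠ {P = _∈ T} (traced-closed tr x∈T) r x∈T))
    escape⊎hit zero T x w∈S r tr disj | inj₂ x∉S | inj₂ x∉T =
      ≤-trans (≤-reflexive (sym (walk-zero _ _ x∉T ω))) (m≤m+n _ _)
    escape⊎hit (suc l) {S} T x w∈S r tr disj | inj₂ x∉S | inj₂ x∉T =
      ≤-trans (escape⊎hit l (x ∷ T) (next ω x) w∈S (tail r w∈S) (traced-next tr) disj′)
        (≤-reflexive (sym (cong₂ _+_ (walk-suc _ _ l x∉T ω)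
                                     (walk-suc _ _ l (λ x∈ → [ x∉T , x∉S ]′ (∈-++⁻ T x∈)) ω))))
      where
      tail : ∀ {w} → ω ⊢ x ↠ w → w ∈ S → ω ⊢ next ω x ↠ w
      tail ε          x∈S = contradiction x∈S x∉S
      tail (refl ◅ r) _   = r
      disj′ : ∀ {y} → y ∈ x ∷ T → y ∉ S
      disj′ (here refl) = x∉S
      disj′ (there y∈T) = disj y∈T

  -- Components of `outGraph ω` in terms of orbits.

  ⊕-card-0 : (u : V n) (s : Subset n) → ∣ s ∣ˢ ≡ 0 → u ⊕ s ≡ u
  ⊕-card-0 []      []          _  = refl
  ⊕-card-0 (b ∷ u) (false ∷ s) eq = cong₂ _∷_ (Bool.xor-identityʳ b) (⊕-card-0 u s eq)

  ∉-card-0 : (s : Subset n) → ∣ s ∣ˢ ≡ 0 → ∀ {i} → ¬ (i ∈ˢ s)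
  ∉-card-0 (false ∷ s) eq (thereˢ i∈) = ∉-card-0 s eq i∈

  -- A one-element set containing `i` is the singleton of `i`, so adding it flips coordinate `i` and
  -- nothing else.
  differOnlyAt⇒⊕ : (s : Subset n) → ∣ s ∣ˢ ≡ 1 → ∀ {i u v} → i ∈ˢ s → DifferOnlyAt i u v → v ≡ u ⊕ s
  differOnlyAt⇒⊕ (true ∷ s) eq {zero} {b ∷ u} {c ∷ v} _ (b≢c , same) =
    cong₂ _∷_ (≢⇒xor b c b≢c) (trans (Pointwise-≡⇒≡ (ext λ j → sym (same (suc j) λ ()))) (sym (⊕-card-0 u s (suc-injective eq))))
    where
    ≢⇒xor : ∀ b c → b ≢ c → c ≡ b xor true
    ≢⇒xor false false b≢c = contradiction refl b≢c
    ≢⇒xor false true  _   = refl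
    ≢⇒xor true  false _   = refl
    ≢⇒xor true  true  b≢c = contradiction refl b≢c
  differOnlyAt⇒⊕ (true ∷ s) eq {suc i} (thereˢ i∈) _ = contradiction i∈ (∉-card-0 s (suc-injective eq))
  differOnlyAt⇒⊕ (false ∷ s) eq {suc i} {b ∷ u} {c ∷ v} (thereˢ i∈) (u≢v , same) =
    cong₂ _∷_ (trans (sym (same zero λ ())) (sym (Bool.xor-identityʳ b)))
      (differOnlyAt⇒⊕ s eq i∈ (u≢v , λ j j≢i → same (suc j) (j≢i ∘ suc-injectiveᶠ)))

  module _ (ω : Choice n) (∣ω∣≡1 : ∀ v → ∣ ω v ∣ˢ ≡ 1) where

    open Graph (outGraph ω) using (Connected; connected?; component)

    adj⇒next : ∀ {u v} → Graph.Adj (outGraph ω) u v → v ≡ next ω u ⊎ u ≡ next ω v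
    adj⇒next {u} {v} (i , diff , inj₁ i∈) = inj₁ (differOnlyAt⇒⊕ (ω u) (∣ω∣≡1 u) i∈ diff)
    adj⇒next {u} {v} (i , diff , inj₂ i∈) =
      inj₂ (differOnlyAt⇒⊕ (ω v) (∣ω∣≡1 v) i∈ (differOnlyAt-sym i u v diff))

    -- Induction along the path. A first edge chosen by `u` prolongs the orbit; one chosen by its
    -- other end is absorbed, since that end has only one successor, namely `u`.
    connected⇒coalesce : ∀ {u v} → Connected u v → ∃[ w ] (ω ⊢ u ↠ w × ω ⊢ v ↠ w)
    connected⇒coalesce {u} ε = u , ε , ε
    connected⇒coalesce (e ◅ q) with adj⇒next e | connected⇒coalesce q
    ... | inj₁ eq   | w , r        , r′ = w , eq ◅ r , r′
    -- The orbits met at the neighbour that points to `u`; one more step of the orbit of `v` makes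
    -- them meet at `u`.
    ... | inj₂ refl | w , ε        , r′ = _ , ε , r′ ◅◅ (refl ◅ ε)
    ... | inj₂ refl | w , refl ◅ r , r′ = w , r , r′

    -- If the orbit of `u` has not closed up after `L` steps, the trivial bound `2 ^ n` is used.
    -- Otherwise it closes to a set `T`, and the orbit of every `v` in the component runs into `T`:
    -- within `L` steps, which `meet` counts, or else `v` is counted by the last sum.
    component≤ : ∀ L u → length (component u) ≤
      2 ^ n * escape L [] u ω + meet L L [] u ω + ∑ (vertices n) (λ v → escape L [] v ω)
    component≤ L u = go L [] u (λ ()) (here refl)
      where
      open ≤-Reasoning
      esc = ∑ (vertices n) (λ v → escape L [] v ω)

      closed-case : ∀ T → (∀ {y} → y ∈ T → next ω y ∈ T) → u ∈ T →
        length (component u) ≤ ∑ (vertices n) (λ v → hit T L T v ω) + esc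
      closed-case T closed u∈T = begin
        length (component u)
          ≡⟨ length-filter-∑ (connected? u) (vertices n) ⟩
        ∑ (vertices n) (λ v → 𝟙 (connected? u v))
          ≤⟨ ∑-mono (vertices n) bound ⟩
        ∑ (vertices n) (λ v → hit T L T v ω + escape L [] v ω)
          ≡⟨ ∑-+ (vertices n) _ _ ⟩
        ∑ (vertices n) (λ v → hit T L T v ω) + esc ∎
        where
        bound : ∀ v → 𝟙 (connected? u v) ≤ hit T L T v ω + escape L [] v ω
        -- The common vertex `w` lies on the orbit of `u`, hence in the closed set `T`, which serves
        -- as the target `S`.
        bound v = 𝟙-≤ (connected? u v) λ q → let w , u↠w , v↠w = connected⇒coalesce q in
          ≤-trans (escape⊎hit ω L [] v (closed-↠ {P = _∈ T} closed u↠w u∈T) v↠w (λ ()) (λ ()))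
                  (≤-reflexive (+-comm (escape L [] v ω) _))

      go : ∀ l T x → Traced ω T x → u ∈ x ∷ T →
        length (component u) ≤ 2 ^ n * escape l T x ω + meet L l T x ω + esc
      go l T x tr u∈ with toSum (x ∈? T)
      ... | inj₁ x∈T = begin
        length (component u)
          ≤⟨ closed-case T (traced-closed ω tr x∈T) (∈-∷⁻ x∈T u∈) ⟩
        ∑ (vertices n) (λ v → hit T L T v ω) + esc
          ≡⟨ cong (_+ esc) (walk-∈ _ _ l x∈T ω) ⟨
        meet L l T x ω + esc
          ≤⟨ +-monoˡ-≤ esc (m≤n+m (meet L l T x ω) (2 ^ n * escape l T x ω)) ⟩
        2 ^ n * escape l T x ω + meet L l T x ω + esc ∎
      go zero T x tr u∈ | inj₂ x∉T = begin
        length (component u)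
          ≤⟨ length-filter (connected? u) (vertices n) ⟩
        length (vertices n)
          ≡⟨ trans (length-vertices n) (sym (*-identityʳ (2 ^ n))) ⟩
        2 ^ n * 1
          ≡⟨ cong (2 ^ n *_) (walk-zero _ _ x∉T ω) ⟨
        2 ^ n * escape 0 T x ω
          ≤⟨ ≤-trans (m≤m+n _ (meet L 0 T x ω)) (m≤m+n _ esc) ⟩
        2 ^ n * escape 0 T x ω + meet L 0 T x ω + esc ∎
      go (suc l) T x tr u∈ | inj₂ x∉T = begin
        length (component u)
          ≤⟨ go l (x ∷ T) (next ω x) (traced-next ω tr) (there u∈) ⟩
        2 ^ n * escape l (x ∷ T) (next ω x) ω + meet L l (x ∷ T) (next ω x) ω + esc
          ≡⟨ cong₂ (λ a b → 2 ^ n * a + b + esc) (walk-suc _ _ l x∉T ω) (walk-suc _ _ l x∉T ω) ⟨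
        2 ^ n * escape (suc l) T x ω + meet L (suc l) T x ω + esc ∎

  -- Connected pairs and Markov's inequality.

  -- Each of the `c` vertices in the component of `v` contributes a component of order at least `c`
  -- to the sum.
  component-square≤ : (G : Graph n) (v : V n) → let open Graph G in
    length (component v) * length (component v) ≤ ∑ (vertices n) (λ u → length (component u))
  component-square≤ {n} G v = begin
    c * c
      ≡⟨ cong (c *_) (length-filter-∑ (connected? v) (vertices n)) ⟩
    c * ∑ (vertices n) (λ u → 𝟙 (connected? v u))
      ≡⟨ ∑-*ˡ (vertices n) c _ ⟨
    ∑ (vertices n) (λ u → c * 𝟙 (connected? v u))
      ≤⟨ ∑-mono (vertices n) bound ⟩
    ∑ (vertices n) (λ u → length (component u)) ∎
    where
    open ≤-Reasoning
    open Graph G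
    c = length (component v)
    same : ∀ {u} → Connected v u → c ≤ length (component u)
    same {u} v~u = begin
      c
        ≡⟨ length-filter-∑ (connected? v) (vertices n) ⟩
      ∑ (vertices n) (λ w → 𝟙 (connected? v w))
        ≤⟨ ∑-mono (vertices n) (λ w → 𝟙-mono (connected? v w) (connected? u w) (reverse symm v~u ◅◅_)) ⟩
      ∑ (vertices n) (λ w → 𝟙 (connected? u w))
        ≡⟨ length-filter-∑ (connected? u) (vertices n) ⟨
      length (component u) ∎
    bound : ∀ u → c * 𝟙 (connected? v u) ≤ length (component u)
    bound u with toSum (connected? v u)
    ... | inj₁ v~u = ≤-trans (≤-reflexive (trans (cong (c *_) (𝟙-true (connected? v u) v~u)) (*-identityʳ c))) (same v~u)
    ... | inj₂ v≁u = ≤-trans (≤-reflexive (trans (cong (c *_) (𝟙-false (connected? v u) v≁u)) (*-zeroʳ c))) z≤n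

  choices-card : ∀ n k {ω : Choice n} → ω ∈ choices n k → ∀ v → ∣ ω v ∣ˢ ≡ k
  choices-card n k ω∈ v = proj₂ (∈-filter⁻ (λ s → ∣ s ∣ˢ ≟ k) {xs = vertices n} (∈-allMaps⁻ n ω∈ v))

  module _ (n : ℕ) .{{_ : NonZero n}} where

    private
      W = 2 ^ n
      Ω = choices n 1
      N = length Ω
      d≡n : length (kSubsets n 1) ≡ n
      d≡n = trans (length-kSubsets n 1) (nC1≡n n)

    ∑-escape-choices : ∀ l (x : V n) → n ^ suc l * ∑ Ω (escape (suc l) [] x) ≤ n * (N * pred n ^ l)
    ∑-escape-choices l x =
      subst (λ d → d ^ suc l * ∑ Ω (escape (suc l) [] x) ≤ d * (N * pred d ^ l)) d≡n
        (∑-escape-start (kSubsets n 1) l x)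

    ∑-meet-choices : ∀ l (x : V n) → ∑ Ω (meet l l [] x) ≤ N * (suc l * l)
    ∑-meet-choices l x = ∑-meet (kSubsets n 1) {{subst NonZero (sym d≡n) it}} l l [] x

    -- The sum of the orders of the components of all vertices is the number of
    -- connected pairs.
    ∑-components : ∀ l → W * pred n ^ l ≤ n ^ l →
      ∑ Ω (λ ω → ∑ (vertices n) (λ u → length (Graph.component (outGraph ω) u))) ≤
      W * (N * (2 + (2 + l) * suc l))
    ∑-components l small = begin
      ∑ Ω (λ ω → ∑ (vertices n) (λ u → length (Graph.component (outGraph ω) u)))
        ≤⟨ ∑-mono-∈ Ω (λ {ω} ω∈ → ∑-mono (vertices n) (component≤ ω (choices-card n 1 ω∈) (suc l))) ⟩
      ∑ Ω (λ ω → ∑ (vertices n) (λ u → W * e u ω + m u ω + esc ω))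
        ≡⟨ ∑-cong Ω split ⟩
      ∑ Ω (λ ω → W * esc ω + ∑ (vertices n) (λ u → m u ω) + W * esc ω)
        ≡⟨ trans (∑-+ Ω _ _) (cong₂ _+_ (∑-+ Ω _ _) refl) ⟩
      ∑ Ω (λ ω → W * esc ω) + ∑ Ω (λ ω → ∑ (vertices n) (λ u → m u ω)) + ∑ Ω (λ ω → W * esc ω)
        ≤⟨ +-mono-≤ (+-mono-≤ ∑-esc ∑-m) ∑-esc ⟩
      W * N + W * (N * ((2 + l) * suc l)) + W * N
        ≡⟨ collect W N ((2 + l) * suc l) ⟩
      W * (N * (2 + (2 + l) * suc l)) ∎
      where
      open ≤-Reasoning
      e m : V n → Choice n → ℕ
      e u = escape (suc l) [] u
      m u = meet (suc l) (suc l) [] u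
      esc : Choice n → ℕ
      esc ω = ∑ (vertices n) (λ v → e v ω)

      collect : ∀ w n r → w * n + w * (n * r) + w * n ≡ w * (n * (2 + r))
      collect = solve-∀

      split : ∀ ω → ∑ (vertices n) (λ u → W * e u ω + m u ω + esc ω) ≡
                    W * esc ω + ∑ (vertices n) (λ u → m u ω) + W * esc ω
      split ω = begin-equality
        ∑ (vertices n) (λ u → W * e u ω + m u ω + esc ω)
          ≡⟨ trans (∑-+ (vertices n) _ _) (cong₂ _+_ (∑-+ (vertices n) _ _) (∑-const (vertices n) (esc ω))) ⟩
        ∑ (vertices n) (λ u → W * e u ω) + ∑ (vertices n) (λ u → m u ω) + length (vertices n) * esc ω
          ≡⟨ cong₂ (λ a b → a + ∑ (vertices n) (λ u → m u ω) + b * esc ω)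
               (∑-*ˡ (vertices n) W _) (length-vertices n) ⟩
        W * esc ω + ∑ (vertices n) (λ u → m u ω) + W * esc ω ∎

      ∑-m : ∑ Ω (λ ω → ∑ (vertices n) (λ u → m u ω)) ≤ W * (N * ((2 + l) * suc l))
      ∑-m = begin
        ∑ Ω (λ ω → ∑ (vertices n) (λ u → m u ω))
          ≡⟨ ∑-swap Ω (vertices n) _ ⟩
        ∑ (vertices n) (λ u → ∑ Ω (m u))
          ≤⟨ ∑-bound (vertices n) _ _ (λ {u} _ → ∑-meet-choices (suc l) u) ⟩
        length (vertices n) * (N * ((2 + l) * suc l))
          ≡⟨ cong (_* (N * ((2 + l) * suc l))) (length-vertices n) ⟩
        W * (N * ((2 + l) * suc l)) ∎

      -- There are `W` starting vertices and each escape is charged `W`. The hypothesis `small` sets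
      -- one of these two factors against the escape probability.
      ∑-esc : ∑ Ω (λ ω → W * esc ω) ≤ W * N
      ∑-esc = *-cancelˡ-≤ (n ^ suc l) {{m^n≢0 n (suc l)}} (begin
        n ^ suc l * ∑ Ω (λ ω → W * esc ω)
          ≡⟨ cong (n ^ suc l *_) (trans (∑-*ˡ Ω W esc) (cong (W *_) (∑-swap Ω (vertices n) _))) ⟩
        n ^ suc l * (W * ∑ (vertices n) (λ v → ∑ Ω (e v)))
          ≡⟨ x∙yz≈y∙xz (n ^ suc l) W _ ⟩
        W * (n ^ suc l * ∑ (vertices n) (λ v → ∑ Ω (e v)))
          ≡⟨ cong (W *_) (∑-*ˡ (vertices n) (n ^ suc l) _) ⟨
        W * ∑ (vertices n) (λ v → n ^ suc l * ∑ Ω (e v))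
          ≤⟨ *-monoʳ-≤ W (∑-bound (vertices n) _ _ (λ {v} _ → ∑-escape-choices l v)) ⟩
        W * (length (vertices n) * (n * (N * pred n ^ l)))
          ≡⟨ cong (λ w → W * (w * (n * (N * pred n ^ l)))) (length-vertices n) ⟩
        W * (W * (n * (N * pred n ^ l)))
          ≡⟨ regroup W n N (pred n ^ l) ⟩
        W * N * n * (W * pred n ^ l)
          ≤⟨ *-monoʳ-≤ (W * N * n) small ⟩
        W * N * n * n ^ l
          ≡⟨ regroup′ W N n (n ^ l) ⟩
        n ^ suc l * (W * N) ∎)
        where
        regroup : ∀ w d n x → w * (w * (d * (n * x))) ≡ w * n * d * (w * x)
        regroup = solve-∀
        regroup′ : ∀ w n d x → w * n * d * x ≡ d * x * (w * n)
        regroup′ = solve-∀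

    -- Markov's inequality for the number of connected pairs: a choice with `P` has a component of
    -- order at least `W / q`, hence at least `(W / q)²` such pairs, while `∑-components` bounds
    -- their total. One factor `W` cancels.
    big-component-count : ∀ l → W * pred n ^ l ≤ n ^ l → ∀ q {P : Choice n → Set p} (P? : U.Decidable P) →
      (∀ {ω} → P ω → ∃[ v ] W ≤ q * length (Graph.component (outGraph ω) v)) →
      length (filter P? Ω) * W ≤ q * q * (2 + (2 + l) * suc l) * N
    big-component-count l small q P? big = *-cancelˡ-≤ W {{m^n≢0 2 n}} (begin
      W * (length (filter P? Ω) * W)
        ≡⟨ regroup W (length (filter P? Ω)) ⟩
      W * W * length (filter P? Ω)
        ≡⟨ cong (W * W *_) (length-filter-∑ P? Ω) ⟩
      W * W * ∑ Ω (𝟙 ∘ P?)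
        ≡⟨ ∑-*ˡ Ω (W * W) _ ⟨
      ∑ Ω (λ ω → W * W * 𝟙 (P? ω))
        ≤⟨ ∑-mono Ω pointwise ⟩
      ∑ Ω (λ ω → q * q * pairs ω)
        ≡⟨ ∑-*ˡ Ω (q * q) pairs ⟩
      q * q * ∑ Ω pairs
        ≤⟨ *-monoʳ-≤ (q * q) (∑-components l small) ⟩
      q * q * (W * (N * (2 + (2 + l) * suc l)))
        ≡⟨ regroup′ (q * q) W N (2 + (2 + l) * suc l) ⟩
      W * (q * q * (2 + (2 + l) * suc l) * N) ∎)
      where
      open ≤-Reasoning
      pairs : Choice n → ℕ
      pairs ω = ∑ (vertices n) (λ u → length (Graph.component (outGraph ω) u))

      regroup : ∀ w b → w * (b * w) ≡ w * w * b
      regroup = solve-∀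
      regroup′ : ∀ c w n r → c * (w * (n * r)) ≡ w * (c * r * n)
      regroup′ = solve-∀
      regroup″ : ∀ q c → q * c * (q * c) ≡ q * q * (c * c)
      regroup″ = solve-∀

      pointwise : ∀ ω → W * W * 𝟙 (P? ω) ≤ q * q * pairs ω
      pointwise ω with P? ω
      ... | no _  = ≤-trans (≤-reflexive (*-zeroʳ (W * W))) z≤n
      ... | yes b = let v , W≤qc = big b; c = length (Graph.component (outGraph ω) v) in begin
        W * W * 1            ≡⟨ *-identityʳ (W * W) ⟩
        W * W                ≤⟨ *-mono-≤ W≤qc W≤qc ⟩
        q * c * (q * c)      ≡⟨ regroup″ q c ⟩
        q * q * (c * c)      ≤⟨ *-monoʳ-≤ (q * q) (component-square≤ (outGraph ω) v) ⟩
        q * q * pairs ω      ∎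

  -- Estimates for powers.

  -- These are the two leading terms of the binomial expansion in powers of `m`.
  m^[1+k]+[1+k]*m^k≤[1+m]^[1+k] : ∀ m k → m ^ suc k + suc k * m ^ k ≤ suc m ^ suc k
  m^[1+k]+[1+k]*m^k≤[1+m]^[1+k] m zero    = ≤-reflexive (base m)
    where
    base : ∀ m → m * 1 + 1 * 1 ≡ suc m * 1
    base = solve-∀
  m^[1+k]+[1+k]*m^k≤[1+m]^[1+k] m (suc k) = begin
    m ^ suc (suc k) + suc (suc k) * m ^ suc k
      ≤⟨ m≤m+n _ (suc k * m ^ k) ⟩
    m ^ suc (suc k) + suc (suc k) * m ^ suc k + suc k * m ^ k
      ≡⟨ expand m k (m ^ k) ⟩
    suc m * (m ^ suc k + suc k * m ^ k)
      ≤⟨ *-monoʳ-≤ (suc m) (m^[1+k]+[1+k]*m^k≤[1+m]^[1+k] m k) ⟩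
    suc m ^ suc (suc k) ∎
    where
    open ≤-Reasoning
    expand : ∀ m k x → m * (m * x) + suc (suc k) * (m * x) + suc k * x ≡ suc m * (m * x + suc k * x)
    expand = solve-∀

  -- With `n = suc m`, the second binomial term `suc m * m ^ m` is at least as large as the first
  -- one, `m ^ suc m`.
  2*[n-1]^n≤n^n : ∀ n .{{_ : NonZero n}} → 2 * pred n ^ n ≤ n ^ n
  2*[n-1]^n≤n^n (suc m) = begin
    2 * m ^ suc m                    ≡⟨ cong (m ^ suc m +_) (+-identityʳ _) ⟩
    m ^ suc m + m * m ^ m            ≤⟨ +-monoʳ-≤ (m ^ suc m) (m≤n+m _ (m ^ m)) ⟩
    m ^ suc m + suc m * m ^ m        ≤⟨ m^[1+k]+[1+k]*m^k≤[1+m]^[1+k] m m ⟩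
    suc m ^ suc m                    ∎
    where open ≤-Reasoning

  *-^-distrib : ∀ a b k → (a * b) ^ k ≡ a ^ k * b ^ k
  *-^-distrib a b zero    = refl
  *-^-distrib a b (suc k) = trans (cong (a * b *_) (*-^-distrib a b k)) ([m*n]*[o*p]≡[m*o]*[n*p] a b (a ^ k) (b ^ k))

  -- The `n`-th power of the preceding bound. It shows that orbits of length about `n * n` are long
  -- enough for the hypothesis `small` of `∑-components`.
  2^n*[n-1]^n²≤n^n² : ∀ n .{{_ : NonZero n}} → 2 ^ n * pred n ^ (n * n) ≤ n ^ (n * n)
  2^n*[n-1]^n²≤n^n² n = begin
    2 ^ n * pred n ^ (n * n)   ≡⟨ cong (2 ^ n *_) (^-*-assoc (pred n) n n) ⟨
    2 ^ n * (pred n ^ n) ^ n   ≡⟨ *-^-distrib 2 (pred n ^ n) n ⟨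
    (2 * pred n ^ n) ^ n       ≤⟨ ^-monoˡ-≤ n (2*[n-1]^n≤n^n n) ⟩
    (n ^ n) ^ n                ≡⟨ ^-*-assoc n n n ⟩
    n ^ (n * n)                ∎
    where open ≤-Reasoning

  n<2^n : ∀ n → n < 2 ^ n
  n<2^n zero    = s≤s z≤n
  n<2^n (suc n) = begin-strict
    suc n            ≤⟨ n<2^n n ⟩
    2 ^ n            <⟨ m<m+n (2 ^ n) (m^n>0 2 n) ⟩
    2 ^ n + 2 ^ n    ≡⟨ cong (2 ^ n +_) (+-identityʳ (2 ^ n)) ⟨
    2 ^ suc n        ∎
    where open ≤-Reasoning

  -- Raise `n ≤ k * suc (n / k) ≤ k * 2 ^ (n / k)` to the power `k`.
  n^k≤k^k*2^n : ∀ k .{{_ : NonZero k}} n → n ^ k ≤ k ^ k * 2 ^ n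
  n^k≤k^k*2^n k n = begin
    n ^ k                        ≤⟨ ^-monoˡ-≤ k n≤k[1+n/k] ⟩
    (k * suc (n / k)) ^ k        ≡⟨ *-^-distrib k (suc (n / k)) k ⟩
    k ^ k * suc (n / k) ^ k      ≤⟨ *-monoʳ-≤ (k ^ k) (^-monoˡ-≤ k (n<2^n (n / k))) ⟩
    k ^ k * (2 ^ (n / k)) ^ k    ≡⟨ cong (k ^ k *_) (^-*-assoc 2 (n / k) k) ⟩
    k ^ k * 2 ^ (n / k * k)      ≤⟨ *-monoʳ-≤ (k ^ k) (^-monoʳ-≤ 2 (m/n*n≤m n k)) ⟩
    k ^ k * 2 ^ n                ∎
    where
    open ≤-Reasoning
    n≤k[1+n/k] : n ≤ k * suc (n / k)
    n≤k[1+n/k] = begin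
      n                    ≡⟨ m≡m%n+[m/n]*n n k ⟩
      n % k + n / k * k    ≤⟨ +-monoˡ-≤ _ (<⇒≤ (m%n<n n k)) ⟩
      k + n / k * k        ≡⟨ *-comm k (suc (n / k)) ⟨
      k * suc (n / k)      ∎

  -- The constants come from 5 c n⁴ < n⁵ / 5⁵ ≤ 2^n.
  poly<2^n : ∀ c n → c * 5 * 5 ^ 5 < n → 2 ≤ n → c * (2 + (2 + n * n) * suc (n * n)) < 2 ^ n
  poly<2^n c n c<n 2≤n = *-cancelˡ-< (5 ^ 5) _ _ (begin-strict
    5 ^ 5 * (c * (2 + (2 + n * n) * suc (n * n)))
      ≤⟨ *-monoʳ-≤ (5 ^ 5) (*-monoʳ-≤ c quartic) ⟩
    5 ^ 5 * (c * (5 * n ^ 4))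
      ≡⟨ regroup (5 ^ 5) c (n ^ 4) ⟩
    c * 5 * 5 ^ 5 * n ^ 4
      <⟨ *-monoˡ-< (n ^ 4) {{m^n≢0 n 4 {{>-nonZero (<-trans (s≤s z≤n) 2≤n)}}}} c<n ⟩
    n ^ 5
      ≤⟨ n^k≤k^k*2^n 5 n ⟩
    5 ^ 5 * 2 ^ n ∎)
    where
    open ≤-Reasoning
    regroup : ∀ k c x → k * (c * (5 * x)) ≡ c * 5 * k * x
    regroup = solve-∀
    2≤n² : 2 ≤ n * n
    2≤n² = ≤-trans 2≤n (m≤m*n n n {{>-nonZero (<-trans (s≤s z≤n) 2≤n)}})
    -- Replacing the leading 2 by `n⁴`, and the 2 and the 1 inside the product by `n²`, gives
    -- `n⁴ + (2n²)²`.
    quartic : 2 + (2 + n * n) * suc (n * n) ≤ 5 * n ^ 4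
    quartic = begin
      2 + (2 + n * n) * suc (n * n)
        ≤⟨ +-mono-≤ (≤-trans 2≤n² (m≤m*n (n * n) (n * n) {{>-nonZero (<-trans (s≤s z≤n) 2≤n²)}}))
                    (*-mono-≤ (+-monoˡ-≤ (n * n) 2≤n²) (+-monoˡ-≤ (n * n) (≤-trans (s≤s z≤n) 2≤n²))) ⟩
      n * n * (n * n) + (n * n + n * n) * (n * n + n * n)
        ≡⟨ collect n ⟩
      5 * n ^ 4 ∎
      where
      collect : ∀ n → n * n * (n * n) + (n * n + n * n) * (n * n + n * n) ≡ 5 * (n * (n * (n * (n * 1))))
      collect = solve-∀

-- Passage to rational numbers and the limit.

open import Data.Integer using (+_)
open import Data.Rational using (ℚ; 0ℚ; _<_; _*_; _/_)
open Counting using (big-component-count; 2^n*[n-1]^n²≤n^n²; poly<2^n)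

-- The numerator of a positive `δ` is at least 1, so it suffices to stay below the reciprocal of its
-- denominator.
ratio<δ : ∀ b m (δ : ℚ) → 0ℚ < δ → (NonZero m → b ℕ.* ℚ.↧ₙ δ ℕ.< m) → ℚ.∣ ratio b m ∣ < δ
-- Here `ratio` takes its default value 0, so the claim is the positivity of `δ`.
ratio<δ b zero    δ 0<δ _ = 0<δ
ratio<δ b (suc m) (ℚ.mkℚ ℤ.+0 _ _)       (ℚ.*<* (ℤ.+<+ ())) _
ratio<δ b (suc m) (ℚ.mkℚ ℤ.-[1+ _ ] _ _) (ℚ.*<* ())         _
ratio<δ b (suc m) δ@(ℚ.mkℚ ℤ.+[1+ a ] d _) _ bd<m =
  subst (_< δ) (sym (ℚ.0≤p⇒∣p∣≡p (ℚ.nonNegative⁻¹ _ {{ℚ.normalize-nonNeg b (suc m)}})))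
    (ℚ.toℚᵘ-cancel-< (ℚᵘ.<-respˡ-≃ (ℚᵘ.≃-sym (ℚ.toℚᵘ-fromℚᵘ (mkℚᵘ (+ b) m)))
      (ℚᵘ.*<* (subst₂ ℤ._<_ (ℤ.pos-* b (suc d)) (ℤ.pos-* (suc a) (suc m))
        (ℤ.+<+ (ℕ.<-≤-trans (bd<m _) (ℕ.m≤m+n (suc m) _)))))))

-- A positive `ε` is at least the reciprocal of its denominator, so that denominator can serve as
-- the natural number `q` in `big-component-count`.
scaled≤⇒ : ∀ (ε : ℚ) → 0ℚ < ε → ∀ w c → ε * (+ w / 1) ℚ.≤ + c / 1 → w ℕ.≤ ℚ.↧ₙ ε ℕ.* c
scaled≤⇒ (ℚ.mkℚ ℤ.+0 _ _)       (ℚ.*<* (ℤ.+<+ ())) _ _ _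
scaled≤⇒ (ℚ.mkℚ ℤ.-[1+ _ ] _ _) (ℚ.*<* ())         _ _ _
scaled≤⇒ ε@(ℚ.mkℚ ℤ.+[1+ p ] q _) _ w c εw≤c = begin
  w                      ≤⟨ ℕ.m≤m+n w _ ⟩
  suc p ℕ.* w            ≡⟨ ℕ.*-identityʳ _ ⟨
  suc p ℕ.* w ℕ.* 1      ≤⟨ ℤ.drop‿+≤+ (subst₂ ℤ._≤_ lhs rhs (ℚᵘ.drop-*≤* unnormalised)) ⟩
  c ℕ.* (suc q ℕ.* 1)    ≡⟨ cong (c ℕ.*_) (ℕ.*-identityʳ (suc q)) ⟩
  c ℕ.* suc q            ≡⟨ ℕ.*-comm c (suc q) ⟩
  suc q ℕ.* c            ∎
  where
  open ℕ.≤-Reasoning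
  unnormalised : mkℚᵘ ℤ.+[1+ p ] q ℚᵘ.* mkℚᵘ (+ w) 0 ℚᵘ.≤ mkℚᵘ (+ c) 0
  unnormalised = ℚᵘ.≤-respʳ-≃ (ℚ.toℚᵘ-fromℚᵘ (mkℚᵘ (+ c) 0))
    (ℚᵘ.≤-respˡ-≃ (ℚᵘ.≃-trans (ℚ.toℚᵘ-homo-* ε (+ w / 1))
                              (ℚᵘ.*-congˡ (ℚ.toℚᵘ-fromℚᵘ (mkℚᵘ (+ w) 0))))
                  (ℚ.toℚᵘ-mono-≤ εw≤c))
  lhs : + suc p ℤ.* + w ℤ.* + 1 ≡ + (suc p ℕ.* w ℕ.* 1)
  lhs = trans (cong (ℤ._* + 1) (sym (ℤ.pos-* (suc p) w))) (sym (ℤ.pos-* (suc p ℕ.* w) 1))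
  rhs : + c ℤ.* + (suc q ℕ.* 1) ≡ + (c ℕ.* (suc q ℕ.* 1))
  rhs = sym (ℤ.pos-* c (suc q ℕ.* 1))

theorem1p1 : ∀ (ε : ℚ) → 0ℚ < ε →
    TendsToZero (λ n →
    ℙ[Q n out 1 ⊨ (λ G → Graph.hasComponentOfOrder≥? G (ε * (+ (2 ^ n) / 1))) ])
-- The threshold ensures both conditions of `poly<2^n`: that `n` exceeds `c * 5 * 5 ^ 5` and that it
-- is at least 2.
theorem1p1 ε 0<ε δ 0<δ = 2 ℕ.+ c ℕ.* 5 ℕ.* 5 ^ 5 , bound
  where
  q = ℚ.↧ₙ ε
  D = ℚ.↧ₙ δ
  -- The factor `q * q` comes from squaring the order of the component, and `D` from comparing the
  -- probability with `δ`.
  c = D ℕ.* (q ℕ.* q)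

  bound : ∀ n → 2 ℕ.+ c ℕ.* 5 ℕ.* 5 ^ 5 ℕ.≤ n →
    ℚ.∣ ℙ[Q n out 1 ⊨ (λ G → Graph.hasComponentOfOrder≥? G (ε * (+ (2 ^ n) / 1))) ] ∣ < δ
  bound n n₀≤n = ratio<δ bad (length (choices n 1)) δ 0<δ λ N≢0 →
    ℕ.*-cancelʳ-< (2 ^ n) _ _ (begin-strict
      bad ℕ.* D ℕ.* 2 ^ n
        ≡⟨ regroup bad D (2 ^ n) ⟩
      D ℕ.* (bad ℕ.* 2 ^ n)
        ≤⟨ ℕ.*-monoʳ-≤ D (big-component-count n {{n≢0}} (n ℕ.* n) (2^n*[n-1]^n²≤n^n² n {{n≢0}}) q P?
             (λ (v , t≤) → v , scaled≤⇒ ε 0<ε (2 ^ n) _ t≤)) ⟩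
      D ℕ.* (q ℕ.* q ℕ.* r ℕ.* length (choices n 1))
        ≡⟨ regroup′ D (q ℕ.* q) r (length (choices n 1)) ⟩
      length (choices n 1) ℕ.* (c ℕ.* r)
        <⟨ ℕ.*-monoʳ-< (length (choices n 1)) {{N≢0}}
             (poly<2^n c n (ℕ.≤-trans (ℕ.n≤1+n _) n₀≤n) (ℕ.≤-trans (ℕ.m≤m+n 2 _) n₀≤n)) ⟩
      length (choices n 1) ℕ.* 2 ^ n ∎)
    where
    open ℕ.≤-Reasoning
    P? : U.Decidable (λ (ω : Choice n) → Graph.HasComponentOfOrder≥ (outGraph ω) (ε * (+ (2 ^ n) / 1)))
    P? ω = Graph.hasComponentOfOrder≥? (outGraph ω) (ε * (+ (2 ^ n) / 1))
    bad = length (filter P? (choices n 1))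
    r = 2 ℕ.+ (2 ℕ.+ n ℕ.* n) ℕ.* suc (n ℕ.* n)
    n≢0 : NonZero n
    n≢0 = >-nonZero (ℕ.≤-trans (s≤s z≤n) n₀≤n)
    regroup : ∀ b d w → b ℕ.* d ℕ.* w ≡ d ℕ.* (b ℕ.* w)
    regroup b d w = trans (cong (ℕ._* w) (ℕ.*-comm b d)) (ℕ.*-assoc d b w)
    regroup′ : ∀ d q r m → d ℕ.* (q ℕ.* r ℕ.* m) ≡ m ℕ.* (d ℕ.* q ℕ.* r)
    regroup′ = solve-∀
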